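{- Let $d$ be a non-negative integer. Then there exist polynomials $F_{1,d}(x),G_{1,d}(x),H_{1,d}(x)$ with real coefficients satisfying $$2\sum_{k=1}^{n}k^ds_{k-1}=F_{1,d}(n)s_{n+1}+G_{1,d}(n)s_n+H_{1,d}(n)\qquad\text{for all } n\in\mathbb N.$$
   Context: $\mathbb N$ denotes the positive integers. Fix $a,b\in\mathbb N$ and $c_0,c_1\in\mathbb Z$ with $(c_0,c_1)\neq(0,0)$. The generalized Fibonacci sequence $(s_n)_{n\ge0}$ is defined by $s_0=c_0$, $s_1=c_1$, and $s_{n+1}=as_n+bs_{n-1}$ for all $n\in\mathbb N$. -}

module Defs where

open import Data.Integer.Base as ℤ using (ℤ; +_)
open import Data.List.Base using (List; []; _∷_)
open import Data.Nat.Base as ℕ using (ℕ; zero; suc)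
import Data.Nat.Properties as ℕₚ
open import Data.Product.Base using (∃-syntax; _,_; _×_; proj₁; proj₂)
open import Data.Rational.Base
open import Data.Rational.Properties
open import Data.Rational.Solver using (module +-*-Solver)
open import Relation.Binary.PropositionalEquality using (_≡_; refl; sym; trans; cong; subst)

-- Real numbers, as Cauchy sequences of rationals.  Two sequences denote
-- the same real number when they are related by _≃ℝ_.

IsCauchy : (ℕ → ℚ) → Set
IsCauchy f = ∀ ε → 0ℚ < ε →
  ∃[ N ] (∀ m n → N ℕ.≤ m → N ℕ.≤ n → ∣ f m - f n ∣ < ε)

record ℝ : Set where
  constructor mkℝ
  field
    seq    : ℕ → ℚ
    cauchy : IsCauchy seq

open ℝ public

infix 4 _≃ℝ_

_≃ℝ_ : ℝ → ℝ → Set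
x ≃ℝ y = ∀ ε → 0ℚ < ε →
  ∃[ N ] (∀ n → N ℕ.≤ n → ∣ seq x n - seq y n ∣ < ε)

fromℚ : ℚ → ℝ
fromℚ q = mkℝ (λ _ → q) λ ε 0<ε →
  0 , λ _ _ _ _ → subst (_< ε) (cong ∣_∣ (sym (+-inverseʳ q))) 0<ε

fromℤ : ℤ → ℝ
fromℤ z = fromℚ (z / 1)

private

  open ≤-Reasoning

  below-⊔ : ∀ {M N k} → M ℕ.⊔ N ℕ.≤ k → M ℕ.≤ k × N ℕ.≤ k
  below-⊔ {M} {N} h = ℕₚ.m⊔n≤o⇒m≤o M N h , ℕₚ.m⊔n≤o⇒n≤o M N h

  scale : ∀ r → .{{Positive r}} → ∀ {q} → 0ℚ < q → 0ℚ < r * q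
  scale r {q} 0<q = subst (_< r * q) (*-zeroʳ r) (*-monoʳ-<-pos r 0<q)

  halves : ∀ ε → ½ * ε + ½ * ε ≡ ε
  halves ε = trans (sym (*-distribʳ-+ ε ½ ½)) (*-identityˡ ε)

  +-cauchy : ∀ {f g} → IsCauchy f → IsCauchy g → IsCauchy (λ n → f n + g n)
  +-cauchy {f} {g} cf cg ε 0<ε
    with cf (½ * ε) (scale ½ 0<ε) | cg (½ * ε) (scale ½ 0<ε)
  ... | M , p | N , q = M ℕ.⊔ N , λ m n hm hn → begin-strict
    ∣ (f m + g m) - (f n + g n) ∣
      ≡⟨ cong ∣_∣ (regroup (f m) (g m) (f n) (g n)) ⟩
    ∣ (f m - f n) + (g m - g n) ∣
      ≤⟨ ∣p+q∣≤∣p∣+∣q∣ (f m - f n) (g m - g n) ⟩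
    ∣ f m - f n ∣ + ∣ g m - g n ∣
      <⟨ +-mono-< (p m n (proj₁ (below-⊔ hm)) (proj₁ (below-⊔ hn)))
                  (q m n (proj₂ (below-⊔ {M} hm)) (proj₂ (below-⊔ {M} hn))) ⟩
    ½ * ε + ½ * ε
      ≡⟨ halves ε ⟩
    ε ∎
    where
    open +-*-Solver
    regroup : ∀ a b c d → (a + b) - (c + d) ≡ (a - c) + (b - d)
    regroup = solve 4 (λ a b c d →
      (a :+ b) :- (c :+ d) := (a :- c) :+ (b :- d)) refl

  eventually-bounded : ∀ {f} → IsCauchy f →
    ∃[ B ] (Positive B × ∃[ N ] (∀ n → N ℕ.≤ n → ∣ f n ∣ ≤ B))
  eventually-bounded {f} cf with cf 1ℚ (positive⁻¹ 1ℚ)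
  ... | N , p = 1ℚ + ∣ f N ∣ , pos+nonNeg⇒pos 1ℚ ∣ f N ∣ {{∣-∣-nonNeg (f N)}} , N ,
    λ n h → begin
    ∣ f n ∣                     ≡⟨ cong ∣_∣ (split (f n) (f N)) ⟩
    ∣ (f n - f N) + f N ∣       ≤⟨ ∣p+q∣≤∣p∣+∣q∣ (f n - f N) (f N) ⟩
    ∣ f n - f N ∣ + ∣ f N ∣     ≤⟨ +-monoˡ-≤ ∣ f N ∣ (<⇒≤ (p n N h ℕₚ.≤-refl)) ⟩
    1ℚ + ∣ f N ∣                ∎
    where
    open +-*-Solver
    split : ∀ a b → a ≡ (a - b) + b
    split = solve 2 (λ a b → a := (a :- b) :+ b) refl

  *-bound : ∀ {B δ} → Positive B → ∀ p q → ∣ p ∣ ≤ B → ∣ q ∣ < δ → ∣ p * q ∣ < B * δ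
  *-bound {B} {δ} B>0 p q ∣p∣≤B ∣q∣<δ = begin-strict
    ∣ p * q ∣      ≡⟨ ∣p*q∣≡∣p∣*∣q∣ p q ⟩
    ∣ p ∣ * ∣ q ∣  ≤⟨ *-monoʳ-≤-nonNeg ∣ q ∣ {{∣-∣-nonNeg q}} ∣p∣≤B ⟩
    B * ∣ q ∣      <⟨ *-monoʳ-<-pos B {{B>0}} ∣q∣<δ ⟩
    B * δ          ∎

  apportion : ∀ {B C} → Positive B → Positive C → ∀ ε → 0ℚ < ε →
    ∃[ δ ] (0ℚ < δ × B * δ + C * δ ≡ ε)
  apportion {B} {C} B>0 C>0 ε 0<ε = 1/D * ε , scale 1/D {{1/pos⇒pos D}} 0<ε ,
    (begin-equality
      B * (1/D * ε) + C * (1/D * ε)  ≡⟨ *-distribʳ-+ (1/D * ε) B C ⟨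
      D * (1/D * ε)                  ≡⟨ *-assoc D 1/D ε ⟨
      D * 1/D * ε                    ≡⟨ cong (_* ε) (*-inverseʳ D) ⟩
      1ℚ * ε                         ≡⟨ *-identityˡ ε ⟩
      ε                              ∎)
    where
    D : ℚ
    D = B + C
    instance
      D>0 : Positive D
      D>0 = pos+pos⇒pos B {{B>0}} C {{C>0}}
      D≢0 : NonZero D
      D≢0 = pos⇒nonZero D
    1/D : ℚ
    1/D = 1/ D

  *-regroup : ∀ a b c d → a * b - c * d ≡ a * (b - d) + d * (a - c)
  *-regroup = solve 4 (λ a b c d →
    a :* b :- c :* d := a :* (b :- d) :+ d :* (a :- c)) refl
    where open +-*-Solver

  *-close : ∀ {B C δ} → Positive B → Positive C → ∀ a b c d →
    ∣ a ∣ ≤ B → ∣ d ∣ ≤ C → ∣ a - c ∣ < δ → ∣ b - d ∣ < δ →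
    ∣ a * b - c * d ∣ < B * δ + C * δ
  *-close {B} {C} {δ} B>0 C>0 a b c d ∣a∣≤B ∣d∣≤C a~c b~d = begin-strict
    ∣ a * b - c * d ∣                  ≡⟨ cong ∣_∣ (*-regroup a b c d) ⟩
    ∣ a * (b - d) + d * (a - c) ∣      ≤⟨ ∣p+q∣≤∣p∣+∣q∣ (a * (b - d)) (d * (a - c)) ⟩
    ∣ a * (b - d) ∣ + ∣ d * (a - c) ∣  <⟨ +-mono-< (*-bound {B} {δ} B>0 a (b - d) ∣a∣≤B b~d)
                                                  (*-bound {C} {δ} C>0 d (a - c) ∣d∣≤C a~c) ⟩
    B * δ + C * δ                      ∎

  *-cauchy : ∀ {f g} → IsCauchy f → IsCauchy g → IsCauchy (λ n → f n * g n)
  *-cauchy {f} {g} cf cg ε 0<ε =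
    let B , B>0 , K , bf = eventually-bounded {f} cf
        C , C>0 , L , bg = eventually-bounded {g} cg
        δ , 0<δ , total  = apportion {B} {C} B>0 C>0 ε 0<ε
        M , p            = cf δ 0<δ
        N , q            = cg δ 0<δ
    in (K ℕ.⊔ L) ℕ.⊔ (M ℕ.⊔ N) , λ m n hm hn →
      let KL≤m , MN≤m = below-⊔ {K ℕ.⊔ L} {M ℕ.⊔ N} hm
          KL≤n , MN≤n = below-⊔ {K ℕ.⊔ L} {M ℕ.⊔ N} hn
          K≤m , _     = below-⊔ {K} {L} KL≤m
          _ , L≤n     = below-⊔ {K} {L} KL≤n
          M≤m , N≤m   = below-⊔ {M} {N} MN≤m
          M≤n , N≤n   = below-⊔ {M} {N} MN≤n
      in subst (∣ f m * g m - f n * g n ∣ <_) total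
           (*-close {B} {C} {δ} B>0 C>0 (f m) (g m) (f n) (g n)
             (bf m K≤m) (bg n L≤n) (p m n M≤m M≤n) (q m n N≤m N≤n))

infixl 6 _+ℝ_
infixl 7 _*ℝ_

_+ℝ_ : ℝ → ℝ → ℝ
x +ℝ y = mkℝ (λ n → seq x n + seq y n) (+-cauchy {seq x} {seq y} (cauchy x) (cauchy y))

_*ℝ_ : ℝ → ℝ → ℝ
x *ℝ y = mkℝ (λ n → seq x n * seq y n) (*-cauchy {seq x} {seq y} (cauchy x) (cauchy y))

-- A polynomial with real coefficients is its list of coefficients, in
-- order of increasing degree; trailing zeros are permitted.

Polynomial : Set
Polynomial = List ℝ

eval : Polynomial → ℝ → ℝ
eval []      x = fromℤ (+ 0)
eval (c ∷ p) x = c +ℝ x *ℝ eval p x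

fib : (a b : ℕ) (c₀ c₁ : ℤ) → ℕ → ℤ
fib a b c₀ c₁ zero          = c₀
fib a b c₀ c₁ (suc zero)    = c₁
fib a b c₀ c₁ (suc (suc n)) =
  + a ℤ.* fib a b c₀ c₁ (suc n) ℤ.+ + b ℤ.* fib a b c₀ c₁ n

-- sumFrom1 n f = f 1 + f 2 + ⋯ + f n
sumFrom1 : ℕ → (ℕ → ℤ) → ℤ
sumFrom1 zero    f = + 0
sumFrom1 (suc n) f = sumFrom1 n f ℤ.+ f (suc n)

{-# OPTIONS --safe #-}
-- Write E for the shift x ↦ x + 1 and Δ = E − 1.  The difference between n + 1
-- and n of F(n) s(n+1) + G(n) s(n) is p(n+1) s(n) as soon as
-- G(x) = b F(x+1) − p(x+1) and (a E + b E² − 1) F = E² p.  The operator on the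
-- left is (a + b − 1) + (a + b) Δ + b E Δ, a nonzero constant plus a
-- degree-lowering part, so it can be inverted on polynomials by recursion on
-- the degree.
module Submission where

open import Defs
open import Data.Integer.Base using (ℤ; +_; 0ℤ; _*_; _^_)
open import Data.Nat.Base using (ℕ; suc; _∸_; NonZero)
open import Data.Product.Base using (_,_; Σ-syntax)
open import Relation.Binary.PropositionalEquality using (_≢_)

import Data.Integer.Base as ℤ
import Data.Integer.Properties as ℤₚ
import Data.List.Base as List
open import Data.Nat.Base using (zero)
import Data.Nat.Base as ℕ
import Data.Nat.Properties as ℕₚ
open import Data.Rational.Base as ℚ
  using (ℚ; 0ℚ; 1ℚ; _/_; 1/_; toℚᵘ; _+_; _-_; -_) renaming (_*_ to _·_)
import Data.Rational.Properties as ℚₚ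
open import Data.Rational.Solver using (module +-*-Solver)
open import Data.Rational.Unnormalised.Base as ℚᵘ using (mkℚᵘ)
import Data.Rational.Unnormalised.Properties as ℚᵘₚ
open import Data.Vec.Base using (Vec; []; _∷_; _∷ʳ_; map; zipWith; toList)
open import Relation.Binary.PropositionalEquality
  using (_≡_; refl; sym; trans; cong; cong₂; subst; module ≡-Reasoning)

open +-*-Solver using (solve; con; _:=_; _:+_; _:*_; _:-_; :-_)

private
  variable
    n : ℕ

-- Integers inside the rationals.

ι : ℤ → ℚ
ι i = i / 1

-- `_/_` normalises by a gcd, so `ι i` is stuck for a variable `i`. Ring identities are therefore
-- transferred from unnormalised fractions with denominator 1.
toℚᵘ-ι : ∀ i → toℚᵘ (ι i) ℚᵘ.≃ mkℚᵘ i 0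
toℚᵘ-ι i = ℚₚ.toℚᵘ-fromℚᵘ (mkℚᵘ i 0)

ι-+ : ∀ i j → ι (i ℤ.+ j) ≡ ι i + ι j
ι-+ i j = ℚₚ.toℚᵘ-injective (begin
  toℚᵘ (ι (i ℤ.+ j))             ≈⟨ toℚᵘ-ι (i ℤ.+ j) ⟩
  mkℚᵘ (i ℤ.+ j) 0               ≡⟨ cong (λ k → mkℚᵘ k 0) (cong₂ ℤ._+_ (ℤₚ.*-identityʳ i) (ℤₚ.*-identityʳ j)) ⟨
  mkℚᵘ i 0 ℚᵘ.+ mkℚᵘ j 0         ≈⟨ ℚᵘₚ.+-cong (toℚᵘ-ι i) (toℚᵘ-ι j) ⟨
  toℚᵘ (ι i) ℚᵘ.+ toℚᵘ (ι j)     ≈⟨ ℚₚ.toℚᵘ-homo-+ (ι i) (ι j) ⟨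
  toℚᵘ (ι i + ι j)               ∎)
  where open import Relation.Binary.Reasoning.Setoid ℚᵘₚ.≃-setoid

ι-* : ∀ i j → ι (i * j) ≡ ι i · ι j
ι-* i j = ℚₚ.toℚᵘ-injective (begin
  toℚᵘ (ι (i * j))               ≈⟨ toℚᵘ-ι (i * j) ⟩
  mkℚᵘ i 0 ℚᵘ.* mkℚᵘ j 0         ≈⟨ ℚᵘₚ.*-cong (toℚᵘ-ι i) (toℚᵘ-ι j) ⟨
  toℚᵘ (ι i) ℚᵘ.* toℚᵘ (ι j)     ≈⟨ ℚₚ.toℚᵘ-homo-* (ι i) (ι j) ⟨
  toℚᵘ (ι i · ι j)               ∎)
  where open import Relation.Binary.Reasoning.Setoid ℚᵘₚ.≃-setoid

ι-suc : ∀ m → ι (+ suc m) ≡ ι (+ m) + 1ℚ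
ι-suc m = trans (cong (λ k → ι (+ k)) (sym (ℕₚ.+-comm m 1))) (ι-+ (+ m) (+ 1))

-- Polynomials with rational coefficients, shift and difference.

-- A vector of length n stands for a polynomial of degree < n, so that lowering
-- the degree is visible in the type and L⁻¹ is structurally recursive.
⟦_⟧ : Vec ℚ n → ℚ → ℚ
⟦ [] ⟧    x = 0ℚ
⟦ c ∷ p ⟧ x = c + x · ⟦ p ⟧ x

infixl 6 _⊕_
infixr 7 _⊙_

_⊕_ : Vec ℚ n → Vec ℚ n → Vec ℚ n
_⊕_ = zipWith _+_

_⊙_ : ℚ → Vec ℚ n → Vec ℚ n
r ⊙ p = map (r ·_) p

⟦⟧-⊕ : ∀ (p q : Vec ℚ n) x → ⟦ p ⊕ q ⟧ x ≡ ⟦ p ⟧ x + ⟦ q ⟧ x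
⟦⟧-⊕ []      []      x = refl
⟦⟧-⊕ (c ∷ p) (d ∷ q) x = trans (cong (λ e → (c + d) + x · e) (⟦⟧-⊕ p q x))
  (regroup c d x (⟦ p ⟧ x) (⟦ q ⟧ x))
  where
  regroup : ∀ c d x u v → (c + d) + x · (u + v) ≡ (c + x · u) + (d + x · v)
  regroup = solve 5 (λ c d x u v →
    (c :+ d) :+ x :* (u :+ v) := (c :+ x :* u) :+ (d :+ x :* v)) refl

⟦⟧-⊙ : ∀ r (p : Vec ℚ n) x → ⟦ r ⊙ p ⟧ x ≡ r · ⟦ p ⟧ x
⟦⟧-⊙ r []      x = sym (ℚₚ.*-zeroʳ r)
⟦⟧-⊙ r (c ∷ p) x = trans (cong (λ e → r · c + x · e) (⟦⟧-⊙ r p x))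
  (factor r c x (⟦ p ⟧ x))
  where
  factor : ∀ r c x u → r · c + x · (r · u) ≡ r · (c + x · u)
  factor = solve 4 (λ r c x u → r :* c :+ x :* (r :* u) := r :* (c :+ x :* u)) refl

⟦⟧-∷ʳ0 : ∀ (p : Vec ℚ n) x → ⟦ p ∷ʳ 0ℚ ⟧ x ≡ ⟦ p ⟧ x
⟦⟧-∷ʳ0 []      x = trans (ℚₚ.+-identityˡ (x · 0ℚ)) (ℚₚ.*-zeroʳ x)
⟦⟧-∷ʳ0 (c ∷ p) x = cong (λ e → c + x · e) (⟦⟧-∷ʳ0 p x)

-- From p(x) = c + x q(x) follows p(x+1) = (c + x q(x+1)) + q(x+1). The final zero pads the second
-- summand to the common length.
shift : Vec ℚ n → Vec ℚ n
shift []      = []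
shift (c ∷ p) = (c ∷ shift p) ⊕ (shift p ∷ʳ 0ℚ)

⟦⟧-shift : ∀ (p : Vec ℚ n) x → ⟦ shift p ⟧ x ≡ ⟦ p ⟧ (x + 1ℚ)
⟦⟧-shift []      x = refl
⟦⟧-shift (c ∷ p) x = begin
  ⟦ (c ∷ shift p) ⊕ (shift p ∷ʳ 0ℚ) ⟧ x
    ≡⟨ ⟦⟧-⊕ (c ∷ shift p) (shift p ∷ʳ 0ℚ) x ⟩
  (c + x · ⟦ shift p ⟧ x) + ⟦ shift p ∷ʳ 0ℚ ⟧ x
    ≡⟨ cong (λ e → (c + x · ⟦ shift p ⟧ x) + e) (⟦⟧-∷ʳ0 (shift p) x) ⟩
  (c + x · ⟦ shift p ⟧ x) + ⟦ shift p ⟧ x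
    ≡⟨ cong (λ e → (c + x · e) + e) (⟦⟧-shift p x) ⟩
  (c + x · ⟦ p ⟧ (x + 1ℚ)) + ⟦ p ⟧ (x + 1ℚ)
    ≡⟨ collect c x (⟦ p ⟧ (x + 1ℚ)) ⟩
  c + (x + 1ℚ) · ⟦ p ⟧ (x + 1ℚ) ∎
  where
  open ≡-Reasoning
  collect : ∀ c x u → (c + x · u) + u ≡ c + (x + 1ℚ) · u
  collect = solve 3 (λ c x u → (c :+ x :* u) :+ u := c :+ (x :+ con 1ℚ) :* u) refl

-- Uses the product rule Δ(c + x q) = x Δq + E q. Subtracting `p` from `shift p` would only put a
-- zero at the top; this form makes the vector shorter.
Δ : Vec ℚ (suc n) → Vec ℚ n
Δ (c ∷ [])        = []
Δ (c ∷ p@(_ ∷ _)) = (0ℚ ∷ Δ p) ⊕ shift p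

⟦⟧-Δ : ∀ (p : Vec ℚ (suc n)) x → ⟦ Δ p ⟧ x ≡ ⟦ p ⟧ (x + 1ℚ) - ⟦ p ⟧ x
⟦⟧-Δ (c ∷ []) x = solve 2 (λ c x →
    con 0ℚ := (c :+ (x :+ con 1ℚ) :* con 0ℚ) :- (c :+ x :* con 0ℚ)) refl c x
⟦⟧-Δ (c ∷ p@(_ ∷ _)) x = begin
  ⟦ (0ℚ ∷ Δ p) ⊕ shift p ⟧ x
    ≡⟨ ⟦⟧-⊕ (0ℚ ∷ Δ p) (shift p) x ⟩
  (0ℚ + x · ⟦ Δ p ⟧ x) + ⟦ shift p ⟧ x
    ≡⟨ cong₂ (λ u v → (0ℚ + x · u) + v) (⟦⟧-Δ p x) (⟦⟧-shift p x) ⟩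
  (0ℚ + x · (⟦ p ⟧ (x + 1ℚ) - ⟦ p ⟧ x)) + ⟦ p ⟧ (x + 1ℚ)
    ≡⟨ collect c x (⟦ p ⟧ (x + 1ℚ)) (⟦ p ⟧ x) ⟩
  (c + (x + 1ℚ) · ⟦ p ⟧ (x + 1ℚ)) - (c + x · ⟦ p ⟧ x) ∎
  where
  open ≡-Reasoning
  collect : ∀ c x u v → (0ℚ + x · (u - v)) + u ≡ (c + (x + 1ℚ) · u) - (c + x · v)
  collect = solve 4 (λ c x u v → (con 0ℚ :+ x :* (u :- v)) :+ u :=
    (c :+ (x :+ con 1ℚ) :* u) :- (c :+ x :* v)) refl

monomial : ℚ → ∀ d → Vec ℚ (suc d)
monomial r zero    = r ∷ []
monomial r (suc d) = 0ℚ ∷ monomial r d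

-- Restricted to integer points because the powers in the sum are taken in ℤ.
⟦⟧-monomial : ∀ r d i → ⟦ monomial r d ⟧ (ι i) ≡ r · ι (i ^ d)
⟦⟧-monomial r zero i = solve 2 (λ r x → r :+ x :* con 0ℚ := r :* con 1ℚ) refl r (ι i)
⟦⟧-monomial r (suc d) i = begin
  0ℚ + ι i · ⟦ monomial r d ⟧ (ι i)  ≡⟨ cong (λ e → 0ℚ + ι i · e) (⟦⟧-monomial r d i) ⟩
  0ℚ + ι i · (r · ι (i ^ d))         ≡⟨ swap (ι i) r (ι (i ^ d)) ⟩
  r · (ι i · ι (i ^ d))              ≡⟨ cong (r ·_) (ι-* i (i ^ d)) ⟨
  r · ι (i * i ^ d)                  ∎
  where
  open ≡-Reasoning
  swap : ∀ x r y → 0ℚ + x · (r · y) ≡ r · (x · y)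
  swap = solve 3 (λ x r y → con 0ℚ :+ x :* (r :* y) := r :* (x :* y)) refl

-- Inverting α E + β E² - 1 on polynomials.

module _ (α β : ℚ) .{{_ : ℚ.NonZero (α + β - 1ℚ)}} where

  private
    -- The factor by which `L` multiplies constants.
    γ : ℚ
    γ = α + β - 1ℚ

  L : (ℚ → ℚ) → ℚ → ℚ
  L f x = α · f (x + 1ℚ) + β · f (x + 1ℚ + 1ℚ) - f x

  lower : Vec ℚ (suc n) → Vec ℚ n
  lower p = (α + β) ⊙ Δ p ⊕ β ⊙ shift (Δ p)

  ⟦⟧-lower : ∀ (p : Vec ℚ (suc n)) x → ⟦ lower p ⟧ x ≡ L ⟦ p ⟧ x - γ · ⟦ p ⟧ x
  ⟦⟧-lower p x = begin
    ⟦ lower p ⟧ x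
      ≡⟨ ⟦⟧-⊕ ((α + β) ⊙ Δ p) (β ⊙ shift (Δ p)) x ⟩
    ⟦ (α + β) ⊙ Δ p ⟧ x + ⟦ β ⊙ shift (Δ p) ⟧ x
      ≡⟨ cong₂ _+_ (⟦⟧-⊙ (α + β) (Δ p) x) (⟦⟧-⊙ β (shift (Δ p)) x) ⟩
    (α + β) · ⟦ Δ p ⟧ x + β · ⟦ shift (Δ p) ⟧ x
      ≡⟨ cong₂ (λ u v → (α + β) · u + β · v) (⟦⟧-Δ p x)
           (trans (⟦⟧-shift (Δ p) x) (⟦⟧-Δ p (x + 1ℚ))) ⟩
    (α + β) · (⟦ p ⟧ (x + 1ℚ) - ⟦ p ⟧ x) + β · (⟦ p ⟧ (x + 1ℚ + 1ℚ) - ⟦ p ⟧ (x + 1ℚ))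
      ≡⟨ collect α β (⟦ p ⟧ x) (⟦ p ⟧ (x + 1ℚ)) (⟦ p ⟧ (x + 1ℚ + 1ℚ)) ⟩
    L ⟦ p ⟧ x - γ · ⟦ p ⟧ x ∎
    where
    open ≡-Reasoning
    collect : ∀ α β u v w → (α + β) · (v - u) + β · (w - v) ≡
      (α · v + β · w - u) - (α + β - 1ℚ) · u
    collect = solve 5 (λ α β u v w → (α :+ β) :* (v :- u) :+ β :* (w :- v) :=
      (α :* v :+ β :* w :- u) :- (α :+ β :- con 1ℚ) :* u) refl

  -- If L r = `lower p` = L p - γ p, then L (p - r) = γ p, so (p - r) / γ is a preimage of p. Such
  -- an r comes from the recursive call on the shorter vector `lower p`.
  L⁻¹ : Vec ℚ n → Vec ℚ n
  L⁻¹ {zero}  p = []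
  L⁻¹ {suc n} p = 1/ γ ⊙ (p ⊕ (- 1ℚ) ⊙ (L⁻¹ (lower p) ∷ʳ 0ℚ))

  ⟦⟧-L⁻¹ : ∀ (p : Vec ℚ (suc n)) x →
    ⟦ L⁻¹ p ⟧ x ≡ 1/ γ · (⟦ p ⟧ x + (- 1ℚ) · ⟦ L⁻¹ (lower p) ⟧ x)
  ⟦⟧-L⁻¹ p x = begin
    ⟦ L⁻¹ p ⟧ x
      ≡⟨ ⟦⟧-⊙ (1/ γ) (p ⊕ (- 1ℚ) ⊙ q) x ⟩
    1/ γ · ⟦ p ⊕ (- 1ℚ) ⊙ q ⟧ x
      ≡⟨ cong (1/ γ ·_) (⟦⟧-⊕ p ((- 1ℚ) ⊙ q) x) ⟩
    1/ γ · (⟦ p ⟧ x + ⟦ (- 1ℚ) ⊙ q ⟧ x)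
      ≡⟨ cong (λ e → 1/ γ · (⟦ p ⟧ x + e)) (⟦⟧-⊙ (- 1ℚ) q x) ⟩
    1/ γ · (⟦ p ⟧ x + (- 1ℚ) · ⟦ q ⟧ x)
      ≡⟨ cong (λ e → 1/ γ · (⟦ p ⟧ x + (- 1ℚ) · e)) (⟦⟧-∷ʳ0 (L⁻¹ (lower p)) x) ⟩
    1/ γ · (⟦ p ⟧ x + (- 1ℚ) · ⟦ L⁻¹ (lower p) ⟧ x) ∎
    where
    open ≡-Reasoning
    q : Vec ℚ _
    q = L⁻¹ (lower p) ∷ʳ 0ℚ

  -- `L` reads its argument at three points only, so pointwise equality suffices and function
  -- extensionality is avoided.
  L-cong : ∀ {f g} → (∀ x → f x ≡ g x) → ∀ x → L f x ≡ L g x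
  L-cong eq x = cong₂ _-_
    (cong₂ (λ u v → α · u + β · v) (eq (x + 1ℚ)) (eq (x + 1ℚ + 1ℚ))) (eq x)

  L-L⁻¹ : ∀ (p : Vec ℚ n) x → L ⟦ L⁻¹ p ⟧ x ≡ ⟦ p ⟧ x
  L-L⁻¹ {zero} [] x = solve 2 (λ α β →
      α :* con 0ℚ :+ β :* con 0ℚ :- con 0ℚ := con 0ℚ) refl α β
  L-L⁻¹ {suc n} p x = begin
    L ⟦ L⁻¹ p ⟧ x
      ≡⟨ L-cong (⟦⟧-L⁻¹ p) x ⟩
    L (λ y → 1/ γ · (⟦ p ⟧ y + (- 1ℚ) · ⟦ q ⟧ y)) x
      ≡⟨ linear α β (1/ γ) (⟦ p ⟧ x) (⟦ p ⟧ (x + 1ℚ)) (⟦ p ⟧ (x + 1ℚ + 1ℚ))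
           (⟦ q ⟧ x) (⟦ q ⟧ (x + 1ℚ)) (⟦ q ⟧ (x + 1ℚ + 1ℚ)) ⟩
    1/ γ · (L ⟦ p ⟧ x - L ⟦ q ⟧ x)
      -- Induction hypothesis for `lower p`, then the description of `lower` as L - γ.
      ≡⟨ cong (λ e → 1/ γ · (L ⟦ p ⟧ x - e)) (trans (L-L⁻¹ (lower p) x) (⟦⟧-lower p x)) ⟩
    1/ γ · (L ⟦ p ⟧ x - (L ⟦ p ⟧ x - γ · ⟦ p ⟧ x))
      ≡⟨ cancel (1/ γ) (L ⟦ p ⟧ x) γ (⟦ p ⟧ x) ⟩
    (1/ γ · γ) · ⟦ p ⟧ x
      ≡⟨ cong (_· ⟦ p ⟧ x) (ℚₚ.*-inverseˡ γ) ⟩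
    1ℚ · ⟦ p ⟧ x
      ≡⟨ ℚₚ.*-identityˡ (⟦ p ⟧ x) ⟩
    ⟦ p ⟧ x ∎
    where
    open ≡-Reasoning
    q : Vec ℚ n
    q = L⁻¹ (lower p)
    linear : ∀ α β δ u v w u′ v′ w′ →
      α · (δ · (v + (- 1ℚ) · v′)) + β · (δ · (w + (- 1ℚ) · w′)) - δ · (u + (- 1ℚ) · u′) ≡
      δ · ((α · v + β · w - u) - (α · v′ + β · w′ - u′))
    linear = solve 9 (λ α β δ u v w u′ v′ w′ →
      α :* (δ :* (v :+ con (- 1ℚ) :* v′)) :+ β :* (δ :* (w :+ con (- 1ℚ) :* w′))
        :- δ :* (u :+ con (- 1ℚ) :* u′) :=
      δ :* ((α :* v :+ β :* w :- u) :- (α :* v′ :+ β :* w′ :- u′))) refl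
    cancel : ∀ δ l γ u → δ · (l - (l - γ · u)) ≡ (δ · γ) · u
    cancel = solve 4 (λ δ l γ u → δ :* (l :- (l :- γ :* u)) := (δ :* γ) :* u) refl

  -- The coefficient polynomials F and G.

  coeff₁ coeff₀ : Vec ℚ n → Vec ℚ n
  coeff₁ p = L⁻¹ (shift (shift p))
  coeff₀ p = shift (β ⊙ coeff₁ p ⊕ (- 1ℚ) ⊙ p)

  ⟦⟧-coeff₀ : ∀ (p : Vec ℚ n) x →
    ⟦ coeff₀ p ⟧ x ≡ β · ⟦ coeff₁ p ⟧ (x + 1ℚ) + (- 1ℚ) · ⟦ p ⟧ (x + 1ℚ)
  ⟦⟧-coeff₀ p x = begin
    ⟦ coeff₀ p ⟧ x
      ≡⟨ ⟦⟧-shift (β ⊙ coeff₁ p ⊕ (- 1ℚ) ⊙ p) x ⟩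
    ⟦ β ⊙ coeff₁ p ⊕ (- 1ℚ) ⊙ p ⟧ (x + 1ℚ)
      ≡⟨ ⟦⟧-⊕ (β ⊙ coeff₁ p) ((- 1ℚ) ⊙ p) (x + 1ℚ) ⟩
    ⟦ β ⊙ coeff₁ p ⟧ (x + 1ℚ) + ⟦ (- 1ℚ) ⊙ p ⟧ (x + 1ℚ)
      ≡⟨ cong₂ _+_ (⟦⟧-⊙ β (coeff₁ p) (x + 1ℚ)) (⟦⟧-⊙ (- 1ℚ) p (x + 1ℚ)) ⟩
    β · ⟦ coeff₁ p ⟧ (x + 1ℚ) + (- 1ℚ) · ⟦ p ⟧ (x + 1ℚ) ∎
    where open ≡-Reasoning

  -- Here `u` and `v` stand for s(n+1) and s(n), and their coefficients match separately. For `v`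
  -- this says β F(x+1) = G(x) + p(x+1). For `u` it says α F(x+1) + G(x+1) = F(x), which after
  -- eliminating G becomes L F = E² p.
  coeff-step : ∀ (p : Vec ℚ n) x u v →
    ⟦ coeff₁ p ⟧ (x + 1ℚ) · (α · u + β · v) + ⟦ coeff₀ p ⟧ (x + 1ℚ) · u ≡
    ⟦ coeff₁ p ⟧ x · u + ⟦ coeff₀ p ⟧ x · v + ⟦ p ⟧ (x + 1ℚ) · v
  coeff-step p x u v = begin
    F₁ · (α · u + β · v) + ⟦ coeff₀ p ⟧ (x + 1ℚ) · u
      ≡⟨ cong (λ e → F₁ · (α · u + β · v) + e · u) (⟦⟧-coeff₀ p (x + 1ℚ)) ⟩
    F₁ · (α · u + β · v) + (β · F₂ + (- 1ℚ) · ⟦ p ⟧ (x + 1ℚ + 1ℚ)) · u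
      ≡⟨ cong (λ e → F₁ · (α · u + β · v) + (β · F₂ + (- 1ℚ) · e) · u) LF≡p₂ ⟨
    F₁ · (α · u + β · v) + (β · F₂ + (- 1ℚ) · (α · F₁ + β · F₂ - F₀)) · u
      ≡⟨ collect α β F₀ F₁ F₂ (⟦ p ⟧ (x + 1ℚ)) u v ⟩
    F₀ · u + (β · F₁ + (- 1ℚ) · ⟦ p ⟧ (x + 1ℚ)) · v + ⟦ p ⟧ (x + 1ℚ) · v
      ≡⟨ cong (λ e → F₀ · u + e · v + ⟦ p ⟧ (x + 1ℚ) · v) (⟦⟧-coeff₀ p x) ⟨
    F₀ · u + ⟦ coeff₀ p ⟧ x · v + ⟦ p ⟧ (x + 1ℚ) · v ∎
    where
    open ≡-Reasoning
    F₀ F₁ F₂ : ℚ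
    F₀ = ⟦ coeff₁ p ⟧ x
    F₁ = ⟦ coeff₁ p ⟧ (x + 1ℚ)
    F₂ = ⟦ coeff₁ p ⟧ (x + 1ℚ + 1ℚ)
    LF≡p₂ : L ⟦ coeff₁ p ⟧ x ≡ ⟦ p ⟧ (x + 1ℚ + 1ℚ)
    LF≡p₂ = trans (L-L⁻¹ (shift (shift p)) x)
      (trans (⟦⟧-shift (shift p) x) (⟦⟧-shift p (x + 1ℚ)))
    collect : ∀ α β F₀ F₁ F₂ p₁ u v →
      F₁ · (α · u + β · v) + (β · F₂ + (- 1ℚ) · (α · F₁ + β · F₂ - F₀)) · u ≡
      F₀ · u + (β · F₁ + (- 1ℚ) · p₁) · v + p₁ · v
    collect = solve 8 (λ α β F₀ F₁ F₂ p₁ u v →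
      F₁ :* (α :* u :+ β :* v) :+
        (β :* F₂ :+ con (- 1ℚ) :* (α :* F₁ :+ β :* F₂ :- F₀)) :* u :=
      F₀ :* u :+ (β :* F₁ :+ con (- 1ℚ) :* p₁) :* v :+ p₁ :* v) refl

-- From rationals to reals.

fromℚ-poly : Vec ℚ n → Polynomial
fromℚ-poly p = List.map fromℚ (toList p)

-- Real addition and multiplication act termwise, so evaluation on constant sequences is rational
-- evaluation at each index.
seq-eval : ∀ (p : Vec ℚ n) x k → seq (eval (fromℚ-poly p) (fromℚ x)) k ≡ ⟦ p ⟧ x
seq-eval []      x k = refl
seq-eval (c ∷ p) x k = cong (λ e → c + x · e) (seq-eval p x k)

seq-≡⇒≃ℝ : ∀ {x y} → (∀ k → seq x k ≡ seq y k) → x ≃ℝ y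
seq-≡⇒≃ℝ {x} {y} eq ε 0<ε = 0 , λ k _ →
  subst (ℚ._< ε) (cong ℚ.∣_∣ (sym (x-y≡0 k))) 0<ε
  where
  x-y≡0 : ∀ k → seq x k - seq y k ≡ 0ℚ
  x-y≡0 k = trans (cong (_- seq y k) (eq k)) (ℚₚ.+-inverseʳ (seq y k))

-- The recurrence over ℚ and the summation formula.

a+b-1-nonZero : ∀ a b .{{_ : NonZero a}} .{{_ : NonZero b}} →
  ℚ.NonZero (ι (+ a) + ι (+ b) - 1ℚ)
a+b-1-nonZero (suc a) (suc b) = subst ℚ.NonZero eq (ℚₚ.pos⇒nonZero (ι (+ suc (a ℕ.+ b))))
  where
  instance
    _ : ℚ.Positive (ι (+ suc (a ℕ.+ b)))
    _ = ℚₚ.normalize-pos (suc (a ℕ.+ b)) 1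
  open ≡-Reasoning
  eq : ι (+ suc (a ℕ.+ b)) ≡ ι (+ suc a) + ι (+ suc b) - 1ℚ
  eq = begin
    -- The integer on the next line computes to `+ (a ℕ.+ suc b)`, so only a successor has to be
    -- moved.
    ι (+ suc (a ℕ.+ b))                   ≡⟨ cong (λ m → ι (+ m)) (ℕₚ.+-suc a b) ⟨
    ι (+ suc a ℤ.+ + suc b ℤ.+ ℤ.- (+ 1)) ≡⟨ ι-+ (+ suc a ℤ.+ + suc b) (ℤ.- (+ 1)) ⟩
    ι (+ suc a ℤ.+ + suc b) - 1ℚ          ≡⟨ cong (_- 1ℚ) (ι-+ (+ suc a) (+ suc b)) ⟩
    ι (+ suc a) + ι (+ suc b) - 1ℚ        ∎

ι-fib : ∀ a b c₀ c₁ n → let s = fib a b c₀ c₁ in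
  ι (s (suc (suc n))) ≡ ι (+ a) · ι (s (suc n)) + ι (+ b) · ι (s n)
ι-fib a b c₀ c₁ n = trans (ι-+ (+ a * s (suc n)) (+ b * s n))
  (cong₂ _+_ (ι-* (+ a) (s (suc n))) (ι-* (+ b) (s n)))
  where
  s : ℕ → ℤ
  s = fib a b c₀ c₁

lemma2p4 : (a b : ℕ) .{{_ : NonZero a}} .{{_ : NonZero b}}
    (c₀ c₁ : ℤ) → (c₀ , c₁) ≢ (0ℤ , 0ℤ) →
    let s = fib a b c₀ c₁ in
    (d : ℕ) →
    Σ[ F ∈ Polynomial ] Σ[ G ∈ Polynomial ] Σ[ H ∈ Polynomial ]
    ((n : ℕ) .{{_ : NonZero n}} →
    fromℤ (+ 2 * sumFrom1 n (λ k → (+ k) ^ d * s (k ∸ 1)))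
    ≃ℝ eval F (fromℤ (+ n)) *ℝ fromℤ (s (suc n))
    +ℝ eval G (fromℤ (+ n)) *ℝ fromℤ (s n)
    +ℝ eval H (fromℤ (+ n)))
lemma2p4 a b c₀ c₁ _ d =
  fromℚ-poly F , fromℚ-poly G , fromℚ-poly H , λ n → seq-≡⇒≃ℝ
    {fromℤ (+ 2 * S n)}
    {eval (fromℚ-poly F) (fromℤ (+ n)) *ℝ fromℤ (s (suc n))
     +ℝ eval (fromℚ-poly G) (fromℤ (+ n)) *ℝ fromℤ (s n)
     +ℝ eval (fromℚ-poly H) (fromℤ (+ n))}
    -- At each index both sides are rationals, and the claim is the closed form over ℚ.
    λ k → trans (closed-form n) (sym (cong₂ _+_
      (cong₂ (λ u v → u · ι (s (suc n)) + v · ι (s n))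
        (seq-eval F (ι (+ n)) k) (seq-eval G (ι (+ n)) k))
      (seq-eval H (ι (+ n)) k)))
  where
  instance
    c≢0 : ℚ.NonZero (ι (+ a) + ι (+ b) - 1ℚ)
    c≢0 = a+b-1-nonZero a b
  s : ℕ → ℤ
  s = fib a b c₀ c₁
  S : ℕ → ℤ
  S n = sumFrom1 n (λ k → (+ k) ^ d * s (k ∸ 1))
  p F G : Vec ℚ (suc d)
  -- The factor 2 of the sum is absorbed into p(x) = 2 x^d.
  p = monomial (ι (+ 2)) d
  F = coeff₁ (ι (+ a)) (ι (+ b)) p
  G = coeff₀ (ι (+ a)) (ι (+ b)) p
  T : ℕ → ℚ
  T n = ⟦ F ⟧ (ι (+ n)) · ι (s (suc n)) + ⟦ G ⟧ (ι (+ n)) · ι (s n)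
  H : Vec ℚ 1
  -- Doubled sum and `T` have the same increments, so they differ by a constant; the empty sum at 0
  -- fixes it.
  H = - T 0 ∷ []
  open ≡-Reasoning

  T-suc : ∀ n → T (suc n) ≡ T n + ⟦ p ⟧ (ι (+ suc n)) · ι (s n)
  T-suc n = begin
    ⟦ F ⟧ (ι (+ suc n)) · ι (s (suc (suc n))) + ⟦ G ⟧ (ι (+ suc n)) · ι (s (suc n))
      ≡⟨ cong₂ (λ x w → ⟦ F ⟧ x · w + ⟦ G ⟧ x · ι (s (suc n))) (ι-suc n) (ι-fib a b c₀ c₁ n) ⟩
    ⟦ F ⟧ (ι (+ n) + 1ℚ) · (ι (+ a) · ι (s (suc n)) + ι (+ b) · ι (s n))
      + ⟦ G ⟧ (ι (+ n) + 1ℚ) · ι (s (suc n))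
      ≡⟨ coeff-step (ι (+ a)) (ι (+ b)) p (ι (+ n)) (ι (s (suc n))) (ι (s n)) ⟩
    T n + ⟦ p ⟧ (ι (+ n) + 1ℚ) · ι (s n)
      ≡⟨ cong (λ x → T n + ⟦ p ⟧ x · ι (s n)) (ι-suc n) ⟨
    T n + ⟦ p ⟧ (ι (+ suc n)) · ι (s n) ∎

  -- This is the term k = n + 1, where `s (k ∸ 1)` computes to `s n`.
  summand : ∀ n → ι (+ 2 * ((+ suc n) ^ d * s n)) ≡ ⟦ p ⟧ (ι (+ suc n)) · ι (s n)
  summand n = begin
    ι (+ 2 * ((+ suc n) ^ d * s n))         ≡⟨ cong ι (ℤₚ.*-assoc (+ 2) ((+ suc n) ^ d) (s n)) ⟨
    ι (+ 2 * (+ suc n) ^ d * s n)           ≡⟨ ι-* (+ 2 * (+ suc n) ^ d) (s n) ⟩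
    ι (+ 2 * (+ suc n) ^ d) · ι (s n)       ≡⟨ cong (_· ι (s n)) (ι-* (+ 2) ((+ suc n) ^ d)) ⟩
    ι (+ 2) · ι ((+ suc n) ^ d) · ι (s n)   ≡⟨ cong (_· ι (s n)) (⟦⟧-monomial (ι (+ 2)) d (+ suc n)) ⟨
    ⟦ p ⟧ (ι (+ suc n)) · ι (s n)           ∎

  closed-form : ∀ n → ι (+ 2 * S n) ≡ T n + ⟦ H ⟧ (ι (+ n))
  closed-form zero = solve 1 (λ t → con 0ℚ := t :+ (:- t :+ con 0ℚ :* con 0ℚ)) refl (T 0)
  closed-form (suc n) = begin
    ι (+ 2 * (S n ℤ.+ t))
      ≡⟨ cong ι (ℤₚ.*-distribˡ-+ (+ 2) (S n) t) ⟩
    ι (+ 2 * S n ℤ.+ + 2 * t)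
      ≡⟨ ι-+ (+ 2 * S n) (+ 2 * t) ⟩
    ι (+ 2 * S n) + ι (+ 2 * t)
      ≡⟨ cong₂ _+_ (closed-form n) (summand n) ⟩
    (T n + ⟦ H ⟧ (ι (+ n))) + ⟦ p ⟧ (ι (+ suc n)) · ι (s n)
      -- `H` is constant, so its argument may change from n to n + 1.
      ≡⟨ regroup (T n) (- T 0) (ι (+ n)) (ι (+ suc n)) (⟦ p ⟧ (ι (+ suc n)) · ι (s n)) ⟩
    (T n + ⟦ p ⟧ (ι (+ suc n)) · ι (s n)) + ⟦ H ⟧ (ι (+ suc n))
      ≡⟨ cong (_+ ⟦ H ⟧ (ι (+ suc n))) (T-suc n) ⟨
    T (suc n) + ⟦ H ⟧ (ι (+ suc n)) ∎
    where
    t : ℤ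
    t = (+ suc n) ^ d * s n
    regroup : ∀ u h x y w → (u + (h + x · 0ℚ)) + w ≡ (u + w) + (h + y · 0ℚ)
    regroup = solve 5 (λ u h x y w →
      (u :+ (h :+ x :* con 0ℚ)) :+ w := (u :+ w) :+ (h :+ y :* con 0ℚ)) refl
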